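{- Let $I:\mathsf{Set}$, let $w$ be an indexed container over $I$ and $X$ a predicate on $I$. Then the type $\big([\![w^\ast]\!](X)\between\nu_{w^\bot}\big)\to\big(X\between\nu_{w^\bot}\big)$ is inhabited.
   Context: For predicates $X,Y:I\to\mathsf{Set}$, $X\between Y=\sum_{i:I}X(i)\times Y(i)$. An indexed container is $w=\langle A,D,n\rangle$ with $i[a/d]=n(i,a,d)$, and its extension is $i\in[\![w]\!](X)=\sum_{a}\prod_{d}X(i[a/d])$. The dual $w^\bot$ has $A^\bot(i)=\prod_{a}D(i,a)$, $D^\bot(i,f)=A(i)$ and $n^\bot(i,f,a)=i[a/f\,a]$. Free container $w^\ast$: $A^\ast(i)$ is generated by $\mathtt{Leaf}$ and $\mathtt{Node}(a,k)$ with $k:\prod_{d:D(i,a)}A^\ast(i[a/d])$. Further, $D^\ast(i,\mathtt{Leaf})=\mathbf 1$, $n^\ast(i,\mathtt{Leaf},\star)=i$, $D^\ast(i,\mathtt{Node}(a,k))=\sum_d D^\ast(i[a/d],k\,d)$ and $n^\ast(i,\mathtt{Node}(a,k),\langle d,d'\rangle)=n^\ast(i[a/d],k\,d,d')$. $\nu_v$ is the coinductive predicate with $\nu\mathrm{elim}:\nu_v\subseteq[\![v]\!](\nu_v)$ and $\nu\mathrm{intro}\,c:X\subseteq\nu_v$ for $c:X\subseteq[\![v]\!](X)$. -}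

module Defs where

open import Data.Unit using (⊤; tt)
open import Level using (Level; _⊔_)
open import Data.Product using (Σ; _×_; _,_; proj₁; proj₂)

Pred : Set → Set₁
Pred I = I → Set

_≬_ : {I : Set} {ℓ ℓ′ : Level} → (I → Set ℓ) → (I → Set ℓ′) → Set (ℓ ⊔ ℓ′)
_≬_ {I} X Y = Σ I (λ i → X i × Y i)

_⊆_ : {I : Set} {ℓ ℓ′ : Level} → (I → Set ℓ) → (I → Set ℓ′) → Set (ℓ ⊔ ℓ′)
_⊆_ {I} X Y = (i : I) → X i → Y i

-- Indexed container w = ⟨A, D, n⟩ with i[a/d] = n i a d
record IContainer (I : Set) : Set₁ where
  constructor ⟨_,_,_⟩
  field
    A : I → Set
    D : (i : I) → A i → Set
    n : (i : I) (a : A i) → D i a → I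
open IContainer public

⟦_⟧ : {I : Set} {ℓ : Level} → IContainer I → (I → Set ℓ) → (I → Set ℓ)
⟦ w ⟧ X i = Σ (A w i) (λ a → (d : D w i a) → X (n w i a d))

_⊥ᶜ : {I : Set} → IContainer I → IContainer I
w ⊥ᶜ = ⟨ (λ i → (a : A w i) → D w i a)
       , (λ i f → A w i)
       , (λ i f a → n w i a (f a)) ⟩

module Free {I : Set} (w : IContainer I) where
  data A* : I → Set where
    Leaf : {i : I} → A* i
    Node : {i : I} (a : A w i) → ((d : D w i a) → A* (n w i a d)) → A* i

  D* : (i : I) → A* i → Set
  n* : (i : I) (t : A* i) → D* i t → I
  D* i Leaf = ⊤
  D* i (Node a k) = Σ (D w i a) (λ d → D* (n w i a d) (k d))
  n* i Leaf tt = i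
  n* i (Node a k) (d , d') = n* (n w i a d) (k d) d'

_* : {I : Set} → IContainer I → IContainer I
w * = ⟨ Free.A* w , Free.D* w , Free.n* w ⟩

-- Since --guardedness / --sized-types are
-- not permitted, ν_v is encoded as the (weakly) terminal coalgebra:
-- i ∈ ν_v  iff  i lies in some post-fixed point X ⊆ ⟦v⟧X.
ν : {I : Set} → IContainer I → I → Set₁
ν {I} v i = Σ (I → Set) (λ X → (X ⊆ ⟦ v ⟧ X) × X i)

νelim : {I : Set} {v : IContainer I} → ν v ⊆ ⟦ v ⟧ (ν v)
νelim {v = v} i (X , c , x) with c i x
... | a , k = a , λ d → X , c , k d

νintro : {I : Set} {v : IContainer I} {X : Pred I} →
         X ⊆ ⟦ v ⟧ X → X ⊆ ν v
νintro {X = X} c i x = X , c , x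

module Submission where

open import Level using (Level)
open import Data.Unit using (tt)
open import Data.Product using (_,_)
open import Defs

-- ν is used only through νelim, so any post-fixed point Y of ⟦ w ⊥ᶜ ⟧ works:
-- at each node a, a dual position f : Π a, D a picks the direction f a, and
-- following these choices down the well-founded tree ends at a leaf.
module _ {I : Set} {w : IContainer I} {ℓ : Level} {X : Pred I} {Y : I → Set ℓ}
         (coalg : Y ⊆ ⟦ w ⊥ᶜ ⟧ Y) where
  open Free w

  reach-leaf : ∀ {i} (t : A* i) → ((d : D* i t) → X (n* i t d)) → Y i → X ≬ Y
  reach-leaf {i} Leaf x y = i , x tt , y
  reach-leaf {i} (Node a k) x y =
    let f , y′ = coalg i y in reach-leaf (k (f a)) (λ d → x (f a , d)) (y′ a)

  ⟦*⟧≬post-fixed⇒≬post-fixed : ⟦ w * ⟧ X ≬ Y → X ≬ Y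
  ⟦*⟧≬post-fixed⇒≬post-fixed (i , (t , x) , y) = reach-leaf t x y

lemma4p10 : (I : Set) (w : IContainer I) (X : Pred I) →
    (⟦ w * ⟧ X ≬ ν (w ⊥ᶜ)) → (X ≬ ν (w ⊥ᶜ))
lemma4p10 I w X = ⟦*⟧≬post-fixed⇒≬post-fixed (νelim {v = w ⊥ᶜ})
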